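{- Let $\kappa$ be inaccessible and let $b,h:\kappa\to\kappa$ be increasing functions with $h\leq b$, each $b(\alpha)$ an infinite cardinal and each $h(\alpha)$ a nonzero cardinal. For each cardinal $\lambda<\kappa$ define $D_\lambda=\{\alpha\in\kappa\mid h(\alpha)=\lambda\}$. (i) If there exists a least cardinal $\lambda<\kappa$ such that $D_\lambda$ is cofinal in $\kappa$, then $\mathfrak b_\kappa^{b,h}(\in^*)=\lambda$. (ii) If $D_\lambda$ is bounded in $\kappa$ for all $\lambda<\kappa$ and $h$ is continuous on a stationary set, then $\mathfrak b_\kappa^{b,h}(\in^*)=\kappa$. (iii) If $D_\lambda$ is bounded in $\kappa$ for all $\lambda<\kappa$ and $h$ is discontinuous on a club set, then $\kappa^+\leq\mathfrak b_\kappa^{b,h}(\in^*)$.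
   Context: "Increasing" means not necessarily strictly increasing. An increasing function $h:\kappa\to\mathrm{Ord}$ is continuous (resp. discontinuous) on $A\subseteq\kappa$ if $h(\gamma)=\bigcup_{\alpha<\gamma}h(\alpha)$ (resp. $h(\gamma)>\bigcup_{\alpha<\gamma}h(\alpha)$) for every limit ordinal $\gamma\in A$. $\prod b$ is the set of functions $f$ with domain $\kappa$ and $f(\alpha)\in b(\alpha)$ for all $\alpha$. $\mathrm{Loc}_\kappa^{b,h}$ is the set of functions $\phi$ with domain $\kappa$ such that $\phi(\alpha)\subseteq b(\alpha)$ and $|\phi(\alpha)|<h(\alpha)$ for all $\alpha$. $f\in^*\phi$ means that there is $\beta<\kappa$ with $f(\alpha)\in\phi(\alpha)$ for all $\alpha>\beta$. The avoidance cardinal $\mathfrak b_\kappa^{b,h}(\in^*)$ is the least size of a set $\mathcal F\subseteq\prod b$ such that there is no $\phi\in\mathrm{Loc}_\kappa^{b,h}$ with $f\in^*\phi$ for all $f\in\mathcal F$. -}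

module Defs where

open import Level using (Level; suc; _⊔_)
open import Data.Nat.Base using (ℕ)
open import Data.Product.Base using (∃-syntax; _×_; proj₁)
open import Function.Bundles using (Injection; Bijection)
open import Induction.WellFounded using (WellFounded)
open import Relation.Binary.Bundles using (Setoid)
open import Relation.Binary.Core using (Rel)
open import Relation.Binary.Definitions using (Monotonic₁)
open import Relation.Binary.Structures using (IsStrictTotalOrder)
open import Relation.Binary.PropositionalEquality using (_≡_; setoid; _→-setoid_)
open import Relation.Nullary.Negation.Core using (¬_)
open import Relation.Unary using (Pred; _∈_; _⊆_; _≐_; _≬_; Satisfiable)
open import Relation.Unary.Relation.Binary.Equality using (≐-setoid)
import Relation.Binary.Construct.On as On
import Relation.Binary.Construct.StrictToNonStrict as ToNonStrict

private
  variable
    a b c d : Level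

-- A cardinal number is given by any set of that size: a setoid stands for the
-- cardinality of the set of its equivalence classes, and equality of cardinals
-- is _≈ᶜ_.

infix 4 _≤ᶜ_ _<ᶜ_ _≈ᶜ_

_≤ᶜ_ : Setoid a b → Setoid c d → Set (a ⊔ b ⊔ c ⊔ d)
S ≤ᶜ T = Injection S T

_<ᶜ_ : Setoid a b → Setoid c d → Set (a ⊔ b ⊔ c ⊔ d)
S <ᶜ T = S ≤ᶜ T × ¬ (T ≤ᶜ S)

_≈ᶜ_ : Setoid a b → Setoid c d → Set (a ⊔ b ⊔ c ⊔ d)
S ≈ᶜ T = Bijection S T

-- Elements of a subset are compared in the ambient set, so that different
-- proofs of membership are not counted as different elements.

Subset : (S : Setoid a b) → Pred (Setoid.Carrier S) c → Setoid (a ⊔ c) b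
Subset S P = On.setoid S (proj₁ {B = P})

-- κ⁺, among the cardinals of sets in the universe ℓ.

IsSuccessorCardinal : ∀ {ℓ} → Setoid ℓ ℓ → Setoid ℓ ℓ → Set (suc ℓ)
IsSuccessorCardinal {ℓ} κ κ⁺ =
  κ <ᶜ κ⁺ × (∀ (μ : Setoid ℓ ℓ) → κ <ᶜ μ → κ⁺ ≤ᶜ μ)

record Ordinal (ℓ : Level) : Set (suc ℓ) where
  infix 4 _<_
  field
    Carrier            : Set ℓ
    _<_                : Rel Carrier ℓ
    isStrictTotalOrder : IsStrictTotalOrder _≡_ _<_
    wellFounded        : WellFounded _<_

-- The ordinal κ is identified with the set of its predecessors: its elements
-- are the ordinals below κ, and such an ordinal α is, as a set, ↓ α.

module Below {ℓ} (κ : Ordinal ℓ) where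

  open Ordinal κ public
    renaming (Carrier to K)
    using (_<_)
  open ToNonStrict {A = K} _≡_ _<_ public using (_≤_)

  ↓ : K → Pred K ℓ
  ↓ α β = β < α

  ∣κ∣ : Setoid ℓ ℓ
  ∣κ∣ = setoid K

  ∣_∣ : Pred K ℓ → Setoid ℓ ℓ
  ∣ A ∣ = Subset ∣κ∣ A

  -- Subsets of α up to extensional equality.
  𝒫 : K → Setoid (suc ℓ) ℓ
  𝒫 α = Subset (≐-setoid K ℓ) (_⊆ ↓ α)

  IsCardinal : Pred K ℓ
  IsCardinal α = ∀ β → β < α → ¬ (∣ ↓ β ∣ ≈ᶜ ∣ ↓ α ∣)

  IsInfinite : Pred K ℓ
  IsInfinite α = setoid ℕ ≤ᶜ ∣ ↓ α ∣

  IsLimit : Pred K ℓ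
  IsLimit γ = Satisfiable (↓ γ) × (∀ α → α < γ → ∃[ β ] α < β × β < γ)

  Cofinal : Pred K ℓ → Set ℓ
  Cofinal A = ∀ β → ∃[ α ] α ∈ A × β ≤ α

  Bounded : Pred K ℓ → Set ℓ
  Bounded A = ∃[ β ] (∀ α → α ∈ A → α ≤ β)

  Closed : Pred K ℓ → Set ℓ
  Closed C = ∀ γ → IsLimit γ →
    (∀ α → α < γ → ∃[ β ] β ∈ C × α < β × β < γ) → γ ∈ C

  Club : Pred K ℓ → Set ℓ
  Club C = Closed C × Cofinal C

  Stationary : Pred K ℓ → Set (suc ℓ)
  Stationary S = ∀ (C : Pred K ℓ) → Club C → S ≬ C

  record Inaccessible : Set (suc ℓ) where
    field
      cardinal    : ∀ α → ¬ (∣ ↓ α ∣ ≈ᶜ ∣κ∣)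
      uncountable : setoid ℕ <ᶜ ∣κ∣
      regular     : ∀ (A : Pred K ℓ) → Cofinal A → ∣κ∣ ≤ᶜ ∣ A ∣
      strongLimit : ∀ α → 𝒫 α <ᶜ ∣κ∣

  Increasing : (K → K) → Set ℓ
  Increasing = Monotonic₁ _≤_ _≤_

  -- The union of the ordinals h α for α < γ, as a set of ordinals.
  ⋃< : (K → K) → K → Pred K ℓ
  ⋃< h γ β = ∃[ α ] α < γ × β ∈ ↓ (h α)

  ContinuousOn : (K → K) → Pred K ℓ → Set ℓ
  ContinuousOn h A = ∀ γ → γ ∈ A → IsLimit γ → ↓ (h γ) ≐ ⋃< h γ

  DiscontinuousOn : (K → K) → Pred K ℓ → Set ℓ
  DiscontinuousOn h A = ∀ γ → γ ∈ A → IsLimit γ →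
    ∃[ δ ] ↓ δ ≐ ⋃< h γ × δ < h γ

  -- h and ν give D_ν.
  D : (K → K) → K → Pred K ℓ
  D h ν α = h α ≡ ν

  ∏ : (K → K) → Pred (K → K) ℓ
  ∏ b f = ∀ α → f α ∈ ↓ (b α)

  Loc : (K → K) → (K → K) → Pred (K → Pred K ℓ) ℓ
  Loc b h φ = ∀ α → φ α ⊆ ↓ (b α) × ∣ φ α ∣ <ᶜ ∣ ↓ (h α) ∣

  infix 4 _∈*_
  _∈*_ : (K → K) → (K → Pred K ℓ) → Set ℓ
  f ∈* φ = ∃[ β ] (∀ α → β < α → f α ∈ φ α)

  Unlocalised : (b h : K → K) → Pred (Pred (K → K) ℓ) (suc ℓ)
  Unlocalised b h F =
    F ⊆ ∏ b × ¬ (∃[ φ ] φ ∈ Loc b h × (∀ f → f ∈ F → f ∈* φ))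

  ∣_∣ᶠ : Pred (K → K) ℓ → Setoid ℓ ℓ
  ∣ F ∣ᶠ = Subset (K →-setoid K) F

  -- μ is the avoidance cardinal of b and h.
  IsAvoidanceCardinal : (b h : K → K) → Setoid ℓ ℓ → Set (suc ℓ)
  IsAvoidanceCardinal b h μ =
    (∃[ F ] F ∈ Unlocalised b h × ∣ F ∣ᶠ ≈ᶜ μ) ×
    (∀ F → F ∈ Unlocalised b h → μ ≤ᶜ ∣ F ∣ᶠ)

-- Lower bounds: if F ⊆ ∏ b and the sets E α ⊆ F are too small to contain h α and
-- every f ∈ F lies in E α eventually, then φ α = { f α ∣ f ∈ E α } localises F.
-- When ∣F∣ is below the eventual bound for h, take E α = F for large α. When F is
-- enumerated by κ and h jumps on a club C, let E α consist of the f whose index is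
-- below sup h[γ] for the largest limit γ ≤ α of C, which is less than h γ ≤ h α.
-- Upper bounds: a φ localising the constant functions ξ contains all of h α in φ α
-- at any α bounding the moments after which they are captured for ξ < h α; a
-- stationary set on which h is continuous contains such an α.
module Submission where

open import Defs
open import Axiom.ExcludedMiddle using (ExcludedMiddle)
open import Axiom.Extensionality.Propositional using (Extensionality)
open import Data.Bool.Base using (Bool; true; false; if_then_else_)
open import Data.Nat.Base using (ℕ; zero; suc)
open import Data.Product.Base using (∃-syntax; _×_; _,_; proj₁; proj₂; ∃)
open import Data.Sum.Base using (_⊎_; inj₁; inj₂; fromInj₁)
open import Function.Base using (_∘_; id)
open import Function.Bundles using (Injection)
import Function.Construct.Composition as Comp
import Function.Construct.Identity as Id
open import Induction.WellFounded using (Acc; acc)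
open import Level using (Level; _⊔_; Lift; lift; lower)
open import Relation.Binary.Bundles using (Setoid)
open import Relation.Binary.Definitions using (tri<; tri≈; tri>)
open import Relation.Binary.Structures using (IsStrictTotalOrder)
open import Relation.Binary.PropositionalEquality
  using (_≡_; _≗_; refl; sym; trans; subst; cong; setoid)
open import Relation.Nullary using (¬_; yes; no; does; recompute; contradiction; decidable-stable)
open import Relation.Nullary.Decidable using (dec-true)
open import Relation.Unary using (Pred; _∈_; _⊆_; Satisfiable)

private
  variable
    a b c d i p r : Level

-- Classical choice and the comparison of cardinals.

module Classical (em : ∀ {a} → ExcludedMiddle a)
                 (ext : ∀ {a b} → Extensionality a b) where

  by-contradiction : {P : Set p} → ¬ ¬ P → P
  by-contradiction = decidable-stable em

  -- Excluded middle for arbitrary types amounts to a choice operator: the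
  -- argument is irrelevant, so the element chosen depends on P alone.
  choose : (P : Set p) → .P → P
  choose P = recompute em

  ⟦_⟧ : Set p → Bool
  ⟦ P ⟧ = does (em {P = P})

  ⟦⟧-intro : {P : Set p} → P → ⟦ P ⟧ ≡ true
  ⟦⟧-intro = dec-true em

  ⟦⟧-elim : {P : Set p} → ⟦ P ⟧ ≡ true → P
  ⟦⟧-elim {P = P} eq with yes x ← em {P = P} = x

  -- Schröder-Bernstein for setoids.

  module _ {S : Setoid a b} {T : Setoid c d} (f : S ≤ᶜ T) (g : T ≤ᶜ S) where

    private
      module S = Setoid S
      module T = Setoid T
      module f = Injection f
      module g = Injection g

      data Orbit : S.Carrier → Set (a ⊔ b ⊔ c) where
        start : ∀ {x} → (∀ y → ¬ g.to y S.≈ x) → Orbit x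
        step  : ∀ {x x′} → Orbit x → g.to (f.to x) S.≈ x′ → Orbit x′

      Orbit-resp : ∀ {x x′} → x S.≈ x′ → Orbit x → Orbit x′
      Orbit-resp e (start ∉g) = start λ y ge → ∉g y (S.trans ge (S.sym e))
      Orbit-resp e (step o e′) = step o (S.trans e′ e)

      -- The bijection as a relation: `f` along the orbits that begin outside the image of `g`, and
      -- `g` backwards elsewhere, where every point has a preimage because otherwise it would start
      -- an orbit.
      Match : S.Carrier → T.Carrier → Set _
      Match x y = (Orbit x × f.to x T.≈ y) ⊎ (¬ Orbit x × g.to y S.≈ x)

      match : ∀ x → ∃ (Match x)
      match x with em {P = Orbit x}
      ... | yes o = f.to x , inj₁ (o , T.refl)
      ... | no ¬o with em {P = ∃[ y ] g.to y S.≈ x}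
      ...   | yes (y , e) = y , inj₂ (¬o , e)
      ...   | no ∉g = contradiction (start λ y e → ∉g (y , e)) ¬o

      match⁻¹ : ∀ y → ∃[ x ] Match x y
      match⁻¹ y with em {P = Orbit (g.to y)}
      ... | no ¬o = g.to y , inj₂ (¬o , S.refl)
      ... | yes (start ∉g) = contradiction S.refl (∉g y)
      ... | yes (step {x} o e) = x , inj₁ (o , g.injective e)

      Match-functional : ∀ {x x′ y y′} → Match x y → Match x′ y′ → x S.≈ x′ → y T.≈ y′
      Match-functional (inj₁ (_ , e)) (inj₁ (_ , e′)) x≈ =
        T.trans (T.sym e) (T.trans (f.cong x≈) e′)
      Match-functional (inj₁ (o , _)) (inj₂ (¬o , _)) x≈ =
        contradiction (Orbit-resp x≈ o) ¬o
      Match-functional (inj₂ (¬o , _)) (inj₁ (o , _)) x≈ =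
        contradiction (Orbit-resp (S.sym x≈) o) ¬o
      Match-functional (inj₂ (_ , e)) (inj₂ (_ , e′)) x≈ =
        g.injective (S.trans e (S.trans x≈ (S.sym e′)))

      Match-injective : ∀ {x x′ y y′} → Match x y → Match x′ y′ → y T.≈ y′ → x S.≈ x′
      Match-injective (inj₁ (_ , e)) (inj₁ (_ , e′)) y≈ =
        f.injective (T.trans e (T.trans y≈ (T.sym e′)))
      -- A common value would make the second point the successor of the first on its orbit.
      Match-injective (inj₁ (o , e)) (inj₂ (¬o , e′)) y≈ =
        contradiction (step o (S.trans (g.cong (T.trans e y≈)) e′)) ¬o
      Match-injective (inj₂ (¬o , e)) (inj₁ (o , e′)) y≈ =
        contradiction (step o (S.trans (g.cong (T.trans e′ (T.sym y≈))) e)) ¬o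
      Match-injective (inj₂ (_ , e)) (inj₂ (_ , e′)) y≈ =
        S.trans (S.sym e) (S.trans (g.cong y≈) e′)

    schröder-bernstein : S ≈ᶜ T
    schröder-bernstein = record
      { to = λ x → proj₁ (match x)
      ; cong = λ {x} {x′} → Match-functional (proj₂ (match x)) (proj₂ (match x′))
      ; bijective =
          (λ {x} {x′} → Match-injective (proj₂ (match x)) (proj₂ (match x′))) ,
          λ y → proj₁ (match⁻¹ y) , λ {z} →
            Match-functional (proj₂ (match z)) (proj₂ (match⁻¹ y))
      }

  -- Maximal cliques by a Zorn-style tower, and least cardinals.

  module _ {P : Set p} (R : P → P → Set r)
           (R-irrefl : ∀ {x} → ¬ R x x) (R-sym : ∀ {x y} → R x y → R y x) where

    private
      infix 4 _⊑_

      _⊑_ : (P → Bool) → (P → Bool) → Set p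
      Z ⊑ W = ∀ x → Z x ≡ true → W x ≡ true

      ⊑-antisym : ∀ {Z W} → Z ⊑ W → W ⊑ Z → Z ≡ W
      ⊑-antisym {Z} {W} Z⊑W W⊑Z = ext λ x → lemma (Z⊑W x) (W⊑Z x)
        where
        lemma : ∀ {s t} → (s ≡ true → t ≡ true) → (t ≡ true → s ≡ true) → s ≡ t
        lemma {true}  {t}     f g = sym (f refl)
        lemma {false} {true}  f g = g refl
        lemma {false} {false} f g = refl

      Extends : (P → Bool) → P → Set _
      Extends Z x = ∀ z → Z z ≡ true → R z x

      -- Since `choose` ignores which witness it is given, at most one point is chosen, so `next`
      -- adjoins at most one point.
      Chosen : (P → Bool) → P → Set _
      Chosen Z x = ∃[ e ] x ≡ proj₁ (choose (∃ (Extends Z)) e)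

      next : (P → Bool) → (P → Bool)
      next Z x = ⟦ Z x ≡ true ⊎ Chosen Z x ⟧

      ⋃ : ((P → Bool) → Bool) → (P → Bool)
      ⋃ 𝒞 x = ⟦ ∃[ Z ] 𝒞 Z ≡ true × Z x ≡ true ⟧

      ⊑-next : ∀ {Z} → Z ⊑ next Z
      ⊑-next x x∈Z = ⟦⟧-intro (inj₁ x∈Z)

      -- Subsets are Boolean-valued so that the union of the whole tower is one
      -- of its members without a rise in universe level.
      data Tower : (P → Bool) → Set p where
        step  : ∀ {Z} → Tower Z → Tower (next Z)
        union : ∀ {𝒞} → (∀ Z → 𝒞 Z ≡ true → Tower Z) → Tower (⋃ 𝒞)

      -- Zermelo's comparison of stages. A union none of whose members contains `next W` has all of
      -- them inside `W`. A successor is also compared with the sides exchanged; if both inclusions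
      -- hold, the stages and their successors coincide.
      linear : ∀ {Z W} → Tower Z → Tower W → Z ⊑ W ⊎ next W ⊑ Z
      linear {W = W} (union {𝒞} t) u
        with em {P = ∃[ Z ] 𝒞 Z ≡ true × next W ⊑ Z}
      ... | yes (Z , Z∈𝒞 , W⊑Z) = inj₂ λ x x∈W → ⟦⟧-intro (Z , Z∈𝒞 , W⊑Z x x∈W)
      ... | no ¬above = inj₁ λ x x∈⋃ → below x (⟦⟧-elim x∈⋃)
        where
        below : ∀ x → ∃[ Z ] 𝒞 Z ≡ true × Z x ≡ true → W x ≡ true
        below x (Z , Z∈𝒞 , x∈Z) with linear (t Z Z∈𝒞) u
        ... | inj₁ Z⊑W = Z⊑W x x∈Z
        ... | inj₂ W⊑Z = contradiction (Z , Z∈𝒞 , W⊑Z) ¬above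
      linear (step t) u with linear t u
      ... | inj₂ W⊑Z = inj₂ λ x x∈W → ⊑-next x (W⊑Z x x∈W)
      ... | inj₁ Z⊑W with linear u t
      ...   | inj₂ Z′⊑W = inj₁ Z′⊑W
      ...   | inj₁ W⊑Z with refl ← ⊑-antisym Z⊑W W⊑Z = inj₂ λ x x∈W → x∈W

      Clique : (P → Bool) → Set _
      Clique Z = ∀ {x y} → Z x ≡ true → Z y ≡ true → x ≡ y ⊎ R x y

      Tower⇒Clique : ∀ {Z} → Tower Z → Clique Z
      Tower⇒Clique (step {Z} t) {x} {y} x∈ y∈ = lemma (⟦⟧-elim x∈) (⟦⟧-elim y∈)
        where
        lemma : Z x ≡ true ⊎ Chosen Z x → Z y ≡ true ⊎ Chosen Z y → x ≡ y ⊎ R x y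
        lemma (inj₁ x∈Z) (inj₁ y∈Z) = Tower⇒Clique t x∈Z y∈Z
        lemma (inj₁ x∈Z) (inj₂ (e , refl)) = inj₂ (proj₂ (choose _ e) x x∈Z)
        lemma (inj₂ (e , refl)) (inj₁ y∈Z) = inj₂ (R-sym (proj₂ (choose _ e) y y∈Z))
        lemma (inj₂ (e , refl)) (inj₂ (e′ , refl)) = inj₁ refl
      Tower⇒Clique (union {𝒞} t) {x} {y} x∈ y∈ with ⟦⟧-elim x∈ | ⟦⟧-elim y∈
      ... | Z , Z∈𝒞 , x∈Z | W , W∈𝒞 , y∈W with linear (t Z Z∈𝒞) (t W W∈𝒞)
      ...   | inj₁ Z⊑W = Tower⇒Clique (t W W∈𝒞) (Z⊑W x x∈Z) y∈W
      ...   | inj₂ W⊑Z = Tower⇒Clique (t Z Z∈𝒞) x∈Z (W⊑Z y (⊑-next y y∈W))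

    -- The union `M` of all stages is a stage, so `next M` is contained in `M`. A point extending
    -- `M` would then lie in `M` and be `R`-related to itself.
    maximal-clique : ∃[ Z ] (∀ {x y} → Z x ≡ true → Z y ≡ true → x ≡ y ⊎ R x y) ×
                            ¬ (∃[ x ] ∀ z → Z z ≡ true → R z x)
    maximal-clique = M , Tower⇒Clique M∈T , λ e →
      let x , M<x = choose _ e in
      R-irrefl (M<x x (⟦⟧-intro (next M , ⟦⟧-intro (step M∈T) , ⟦⟧-intro (inj₂ (e , refl)))))
      where
      M : P → Bool
      M = ⋃ λ Z → ⟦ Tower Z ⟧

      M∈T : Tower M
      M∈T = union λ Z → ⟦⟧-elim

  -- A maximal set of families x ∈ ∏ A, any two of which differ in every coordinate,
  -- projects onto some factor.
  module _ {I : Set i} (A : I → Setoid a b) (i₀ : I) where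

    private
      module A i = Setoid (A i)

      Apart : (x y : ∀ i → A.Carrier i) → Set _
      Apart x y = ∀ i → ¬ A._≈_ i (x i) (y i)

    least-cardinal : ∃[ i ] ∀ j → A i ≤ᶜ A j
    least-cardinal
      with maximal-clique Apart (λ x≉x → x≉x i₀ (A.refl i₀)) (λ x≉y i → x≉y i ∘ A.sym i)
    ... | Z , clique , maximal with em {P = ∃[ i ] ∀ y → ∃[ x ] Z x ≡ true × A._≈_ i (x i) y}
    -- If every factor has a value missed by the clique, the missed values form a family apart from
    -- all its members.
    ...   | no ¬onto = contradiction (proj₁ ∘ missed , λ z z∈Z i e → proj₂ (missed i) (z , z∈Z , e)) maximal
      where
      missed : ∀ i → ∃[ y ] ¬ (∃[ x ] Z x ≡ true × A._≈_ i (x i) y)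
      missed i = by-contradiction λ ¬missed → ¬onto (i , λ y → by-contradiction λ ∉Z → ¬missed (y , ∉Z))
    ...   | yes (i , onto) = i , λ j → record
      { to = λ y → family y j
      ; cong = λ {y} {y′} e →
          agree y y′ i (A.trans i (above y) (A.trans i e (A.sym i (above y′)))) j
      ; injective = λ {y} {y′} e →
          A.trans i (A.sym i (above y)) (A.trans i (agree y y′ j e i) (above y′))
      }
      where
      family : A.Carrier i → ∀ j → A.Carrier j
      family y = proj₁ (onto y)

      above : ∀ y → A._≈_ i (family y i) y
      above y = proj₂ (proj₂ (onto y))

      -- Members of the clique sharing one coordinate are not `Apart`, hence equal. This makes the
      -- map into each factor both well defined and injective.
      agree : ∀ y y′ j → A._≈_ j (family y j) (family y′ j) →
              ∀ k → A._≈_ k (family y k) (family y′ k)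
      agree y y′ j e k with clique (proj₁ (proj₂ (onto y))) (proj₁ (proj₂ (onto y′)))
      ... | inj₁ eq = A.reflexive k (cong (λ x → x k) eq)
      ... | inj₂ apart = contradiction e (apart j)

  least-cardinal-in : {I : Set i} (A : I → Setoid a b) (Q : Pred I p) → Satisfiable Q →
                      ∃[ i ] i ∈ Q × (∀ j → j ∈ Q → A i ≤ᶜ A j)
  least-cardinal-in A Q q with least-cardinal {I = ∃ Q} (A ∘ proj₁) q
  ... | (i , i∈Q) , least = i , i∈Q , λ j j∈Q → least (j , j∈Q)

  successor-cardinal : {S T : Setoid a a} → S <ᶜ T → ∃ (IsSuccessorCardinal S)
  successor-cardinal {S = S} {T} S<T = least-cardinal-in id (S <ᶜ_) (T , S<T)

  comparable : (S T : Setoid a b) → S ≤ᶜ T ⊎ T ≤ᶜ S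
  comparable S T with least-cardinal (λ s → if s then S else T) true
  ... | true , least = inj₁ (least false)
  ... | false , least = inj₂ (least true)

-- Order and cardinality below `κ`.

module OrdinalProperties
  (em : ∀ {a} → ExcludedMiddle a) (ext : ∀ {a b} → Extensionality a b)
  {ℓ} (κ : Ordinal ℓ) where

  open Classical em ext
  open Below κ
  open IsStrictTotalOrder (Ordinal.isStrictTotalOrder κ)
    public using (compare; irrefl) renaming (trans to <-trans)

  private
    variable
      x y z : K

  <-≤-trans : x < y → y ≤ z → x < z
  <-≤-trans x<y (inj₁ y<z) = <-trans x<y y<z
  <-≤-trans x<y (inj₂ refl) = x<y

  ≤-<-trans : x ≤ y → y < z → x < z
  ≤-<-trans (inj₁ x<y) y<z = <-trans x<y y<z
  ≤-<-trans (inj₂ refl) y<z = y<z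

  ≮⇒≥ : ¬ x < y → y ≤ x
  ≮⇒≥ {x} {y} x≮y with compare x y
  ... | tri< x<y _ _ = contradiction x<y x≮y
  ... | tri≈ _ x≡y _ = inj₂ (sym x≡y)
  ... | tri> _ _ y<x = inj₁ y<x

  <⇒≱ : x < y → ¬ y ≤ x
  <⇒≱ x<y y≤x = irrefl refl (<-≤-trans x<y y≤x)

  upper-bound : ∀ x y → ∃[ z ] x ≤ z × y ≤ z
  upper-bound x y with compare x y
  ... | tri< x<y _ _ = y , inj₁ x<y , inj₂ refl
  ... | tri≈ _ x≡y _ = y , inj₂ x≡y , inj₂ refl
  ... | tri> _ _ y<x = x , inj₂ refl , inj₁ y<x

  least : (P : Pred K p) → Satisfiable P → ∃[ m ] m ∈ P × (∀ x → x ∈ P → m ≤ x)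
  least P (x , x∈P) = go x (Ordinal.wellFounded κ x) x∈P
    where
    go : ∀ x → Acc _<_ x → x ∈ P → ∃[ m ] m ∈ P × (∀ x → x ∈ P → m ≤ x)
    go x (acc rec) x∈P with em {P = ∃[ y ] y < x × y ∈ P}
    ... | yes (y , y<x , y∈P) = go y (rec y<x) y∈P
    ... | no ¬smaller = x , x∈P , λ y y∈P → ≮⇒≥ λ y<x → ¬smaller (y , y<x , y∈P)

  ⊆⇒≤ᶜ : {A B : Pred K ℓ} → A ⊆ B → ∣ A ∣ ≤ᶜ ∣ B ∣
  ⊆⇒≤ᶜ A⊆B = record { to = λ (x , x∈A) → x , A⊆B x∈A ; cong = id ; injective = id }

  ↓-mono : x ≤ y → ∣ ↓ x ∣ ≤ᶜ ∣ ↓ y ∣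
  ↓-mono x≤y = ⊆⇒≤ᶜ λ z<x → <-≤-trans z<x x≤y

  ⊆⇒≤ᶠ : {F G : Pred (K → K) ℓ} → F ⊆ G → ∣ F ∣ᶠ ≤ᶜ ∣ G ∣ᶠ
  ⊆⇒≤ᶠ F⊆G = record { to = λ (f , f∈F) → f , F⊆G f∈F ; cong = id ; injective = id }

  ∣∣≤κ : (A : Pred K ℓ) → ∣ A ∣ ≤ᶜ ∣κ∣
  ∣∣≤κ A = record { to = proj₁ ; cong = id ; injective = id }

  cardinal-≰ : ∀ {ν β} → IsCardinal ν → β < ν → ¬ ∣ ↓ ν ∣ ≤ᶜ ∣ ↓ β ∣
  cardinal-≰ {β = β} ν-card β<ν ν≤β =
    ν-card β β<ν (schröder-bernstein (↓-mono (inj₁ β<ν)) ν≤β)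

  Image : (X : Setoid ℓ ℓ) → (Setoid.Carrier X → K) → Pred K ℓ
  Image X g k = ∃[ x ] g x ≡ k

  -- `choose` picks a preimage depending only on the point of the image, not on the proof that it is
  -- one.
  Image-≤ᶜ : (X : Setoid ℓ ℓ) (g : Setoid.Carrier X → K) →
             (∀ {x y} → Setoid._≈_ X x y → g x ≡ g y) → ∣ Image X g ∣ ≤ᶜ X
  Image-≤ᶜ X g g-cong = record
    { to = λ (k , w) → proj₁ (choose (∃[ x ] g x ≡ k) w)
    ; cong = λ { {k , w} {_ , w′} refl → Setoid.refl X }
    ; injective = λ { {k , w} {k′ , w′} e →
        trans (sym (proj₂ (choose (∃[ x ] g x ≡ k) w)))
          (trans (g-cong e) (proj₂ (choose (∃[ x ] g x ≡ k′) w′))) }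
    }

-- Bounds from regularity, and closure points.

module InaccessibleProperties
  (em : ∀ {a} → ExcludedMiddle a) (ext : ∀ {a b} → Extensionality a b)
  {ℓ} (κ : Ordinal ℓ) (inaccessible : Below.Inaccessible κ) where

  open Below κ
  open Classical em ext
  open OrdinalProperties em ext κ
  open Inaccessible inaccessible

  -- Otherwise the image of `g` is cofinal, and regularity injects `κ` into it and thence into `X`.
  bound : (X : Setoid ℓ ℓ) → ¬ ∣κ∣ ≤ᶜ X → (g : Setoid.Carrier X → K) →
          (∀ {x y} → Setoid._≈_ X x y → g x ≡ g y) → ∃[ β ] ∀ x → g x < β
  bound X κ≰X g g-cong = by-contradiction λ unbounded →
    κ≰X (Comp.injection (regular (Image X g) λ β → by-contradiction λ below →
      unbounded (β , λ x → by-contradiction λ gx≮β →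
        below (g x , (x , refl) , ≮⇒≥ gx≮β)))
      (Image-≤ᶜ X g g-cong))

  κ≰↓ : ∀ α → ¬ ∣κ∣ ≤ᶜ ∣ ↓ α ∣
  κ≰↓ α κ≤α = cardinal α (schröder-bernstein (∣∣≤κ (↓ α)) κ≤α)

  bound-↓ : ∀ α (g : K → K) → ∃[ β ] ∀ ξ → ξ < α → g ξ < β
  bound-↓ α g =
    let β , g<β = bound ∣ ↓ α ∣ (κ≰↓ α) (g ∘ proj₁) (cong g)
    in β , λ ξ ξ<α → g<β (ξ , ξ<α)

  bound-ℕ : (s : ℕ → K) → ∃[ β ] ∀ n → s n < β
  bound-ℕ s =
    let β , s<β = bound (setoid (Lift ℓ ℕ)) κ≰ℕ (s ∘ lower) (cong (s ∘ lower))
    in β , λ n → s<β (lift n)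
    where
    κ≰ℕ : ¬ ∣κ∣ ≤ᶜ setoid (Lift ℓ ℕ)
    κ≰ℕ κ≤ℕ = proj₂ uncountable (Comp.injection κ≤ℕ record
      { to = lower ; cong = cong lower ; injective = cong lift })

  exceed : ∀ α → ∃[ β ] α < β
  exceed α = let β , α<β = bound-ℕ (λ _ → α) in β , α<β 0

  ClosedUnder : (K → K) → Pred K ℓ
  ClosedUnder g γ = ∀ ξ → ξ < γ → g ξ < γ

  -- `γ` is the supremum of a sequence of length ω from `β`, each term exceeding all values of `g`
  -- below the previous term. Regularity and uncountability keep it below `κ`.
  closure-point : (g : K → K) → ∀ β → ∃[ γ ] β < γ × IsLimit γ × γ ∈ ClosedUnder g
  closure-point g β = γ , s<γ 0 , ((β , s<γ 0) , limit) , closed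
    where
    next : ∀ x → ∃[ y ] x < y × (∀ ξ → ξ < x → g ξ < y)
    next x =
      let y , x<y = exceed x
          z , g<z = bound-↓ x g
          w , y≤w , z≤w = upper-bound y z
      in w , <-≤-trans x<y y≤w , λ ξ ξ<x → <-≤-trans (g<z ξ ξ<x) z≤w

    s : ℕ → K
    s zero = β
    s (suc n) = proj₁ (next (s n))

    s-step : ∀ n → s n < s (suc n)
    s-step n = proj₁ (proj₂ (next (s n)))

    supremum = least (λ γ → ∀ n → s n < γ) (bound-ℕ s)
    γ = proj₁ supremum
    s<γ = proj₁ (proj₂ supremum)

    below : ∀ ξ → ξ < γ → ∃[ n ] ξ < s n
    -- Otherwise `s n < s (suc n) ≤ ξ` for all `n`, so `ξ` would be a strict upper bound smaller
    -- than the least one.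
    below ξ ξ<γ = by-contradiction λ above → <⇒≱ ξ<γ (proj₂ (proj₂ supremum) ξ λ n →
      <-≤-trans (s-step n) (≮⇒≥ λ ξ<s → above (suc n , ξ<s)))

    limit : ∀ ξ → ξ < γ → ∃[ η ] ξ < η × η < γ
    limit ξ ξ<γ = let n , ξ<s = below ξ ξ<γ in s n , ξ<s , s<γ n

    closed : ∀ ξ → ξ < γ → g ξ < γ
    closed ξ ξ<γ =
      let n , ξ<s = below ξ ξ<γ
      in <-trans (proj₂ (proj₂ (next (s n))) ξ ξ<s) (s<γ (suc n))

-- Localising families of functions.

module Localisation
  (em : ∀ {a} → ExcludedMiddle a) (ext : ∀ {a b} → Extensionality a b)
  {ℓ} (κ : Ordinal ℓ) (inaccessible : Below.Inaccessible κ)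
  (b h : Ordinal.Carrier κ → Ordinal.Carrier κ)
  (b↑ : Below.Increasing κ b) (h↑ : Below.Increasing κ h)
  (h≤b : ∀ α → Below._≤_ κ (h α) (b α))
  (b-infinite : ∀ α → Below.IsInfinite κ (b α))
  (h-cardinal : ∀ α → Below.IsCardinal κ (h α))
  (h-nonzero : ∀ α → Satisfiable (Below.↓ κ (h α)))
  where

  open Below κ
  open Classical em ext
  open OrdinalProperties em ext κ
  open InaccessibleProperties em ext κ inaccessible

  -- The common form of the lower bounds. Evaluation at `α` maps `E α` onto `φ α`, which is
  -- therefore too small to contain a copy of `h α`; comparability turns this into `<ᶜ`.
  unlocalised-obstruction :
    ∀ {F} → F ∈ Unlocalised b h → (E : K → Pred (K → K) ℓ) → (∀ α → E α ⊆ F) →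
    (∀ α → ¬ ∣ ↓ (h α) ∣ ≤ᶜ ∣ E α ∣ᶠ) →
    ¬ (∀ f → f ∈ F → ∃[ β ] (∀ α → β < α → f ∈ E α))
  unlocalised-obstruction (F⊆∏b , ¬loc) E E⊆F small eventually =
    ¬loc (φ , (λ α → φ⊆b α , φ<h α) , λ f f∈F →
      let β , f∈E = eventually f f∈F in β , λ α β<α → (f , f∈E α β<α) , refl)
    where
    φ : K → Pred K ℓ
    φ α = Image ∣ E α ∣ᶠ λ (f , _) → f α

    φ⊆b : ∀ α → φ α ⊆ ↓ (b α)
    φ⊆b α ((f , f∈E) , refl) = F⊆∏b (E⊆F α f∈E) α

    φ<h : ∀ α → ∣ φ α ∣ <ᶜ ∣ ↓ (h α) ∣
    φ<h α = fromInj₁ (λ h≤φ → contradiction h≤φ h≰φ) (comparable _ _) , h≰φ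
      where
      h≰φ : ¬ ∣ ↓ (h α) ∣ ≤ᶜ ∣ φ α ∣
      h≰φ h≤φ = small α (Comp.injection h≤φ (Image-≤ᶜ ∣ E α ∣ᶠ _ λ f≗g → f≗g α))

  -- By size `φ α` cannot contain all of `h α`, so it omits a point of `b α`; the omitted points
  -- form a function escaping `φ` everywhere.
  ∏b-unlocalised : ∏ b ∈ Unlocalised b h
  ∏b-unlocalised = id , λ (φ , φ∈Loc , localised) →
    let missed = λ α → by-contradiction {P = ∃[ x ] x < b α × ¬ x ∈ φ α} λ ¬missed →
          proj₂ (proj₂ (φ∈Loc α)) (⊆⇒≤ᶜ λ {x} x<h → by-contradiction λ x∉φ →
            ¬missed (x , <-≤-trans x<h (h≤b α) , x∉φ))
        β , f∈φ = localised (proj₁ ∘ missed) (λ α → proj₁ (proj₂ (missed α)))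
        α , β<α = exceed β
    in proj₂ (proj₂ (missed α)) (f∈φ α β<α)

  -- Upper bounds from constant functions.

  zeroᵇ : ∀ α → ∃[ x ] x < b α
  zeroᵇ α = Injection.to (b-infinite α) 0

  -- The constant function with value ξ, moved into ∏ b where ξ is too large.
  constant : K → K → K
  constant ξ α with em {P = ξ < b α}
  ... | yes _ = ξ
  ... | no _ = proj₁ (zeroᵇ α)

  constant-< : ∀ ξ α → constant ξ α < b α
  constant-< ξ α with em {P = ξ < b α}
  ... | yes ξ<b = ξ<b
  ... | no _ = proj₂ (zeroᵇ α)

  constant-≡ : ∀ ξ α → ξ < b α → constant ξ α ≡ ξ
  constant-≡ ξ α ξ<b with em {P = ξ < b α}
  ... | yes _ = refl
  ... | no ξ≮b = contradiction ξ<b ξ≮b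

  module _ {X : Setoid ℓ ℓ} (e : X ≤ᶜ ∣κ∣) where

    private
      module X = Setoid X
      module e = Injection e

    -- Indexing by an injection into `κ` treats the families of size `ν` and of size `κ` together.
    Constants : Pred (K → K) ℓ
    Constants f = ∃[ x ] f ≡ constant (e.to x)

    -- As `b` is increasing, any two of the values lie below a common `b γ`, where both functions
    -- take their intended values.
    Constants-≈ᶜ : (∀ x → ∃[ α ] e.to x < b α) → ∣ Constants ∣ᶠ ≈ᶜ X
    Constants-≈ᶜ bounded = record
      { to = λ (_ , x , _) → x
      ; cong = λ { {_ , x , refl} {_ , y , refl} f≗g → to-cong x y f≗g }
      ; bijective =
          (λ { {_ , x , refl} {_ , y , refl} x≈y α → cong (λ ξ → constant ξ α) (e.cong x≈y) }) ,
          λ x → (constant (e.to x) , x , refl) , λ { {_ , y , refl} f≗g → to-cong y x f≗g }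
      }
      where
      to-cong : ∀ x y → constant (e.to x) ≗ constant (e.to y) → x X.≈ y
      to-cong x y f≗g =
        let α , x<b = bounded x
            β , y<b = bounded y
            γ , α≤γ , β≤γ = upper-bound α β
        in e.injective (trans (sym (constant-≡ _ γ (<-≤-trans x<b (b↑ α≤γ))))
             (trans (f≗g γ) (constant-≡ _ γ (<-≤-trans y<b (b↑ β≤γ)))))

    -- Apply the hypothesis with `β x` the moment after which the constant indexed by `x` is
    -- captured: at the resulting `α`, all of `h α` lies in `φ α`, against the size of `φ α`.
    Constants-unlocalised :
      (∀ (β : X.Carrier → K) → (∀ {x y} → x X.≈ y → β x ≡ β y) →
        ∃[ α ] ∀ ξ → ξ < h α → ∃[ x ] e.to x ≡ ξ × β x < α) →
      Constants ∈ Unlocalised b h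
    Constants-unlocalised diagonal =
      (λ { (x , refl) α → constant-< (e.to x) α }) ,
      λ (φ , φ∈Loc , localised) →
        let α , covered = diagonal (λ x → from φ localised (e.to x) (x , refl))
                                   (λ {x} {y} x≈y → from-cong φ localised (x , refl) (y , refl) (e.cong x≈y))
        in proj₂ (proj₂ (φ∈Loc α)) (⊆⇒≤ᶜ λ {ξ} ξ<h → captured φ localised ξ ξ<h (covered ξ ξ<h))
      where
      module _ φ (localised : ∀ f → f ∈ Constants → f ∈* φ) where

        -- Irrelevance makes the moment of capture depend on `ξ` alone, which gives the congruence
        -- required of `β`.
        localise : ∀ ξ → .(constant ξ ∈ Constants) → constant ξ ∈* φ
        localise ξ p = localised _ (choose (constant ξ ∈ Constants) p)

        from : ∀ ξ → .(constant ξ ∈ Constants) → K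
        from ξ p = proj₁ (localise ξ p)

        from-cong : ∀ {ξ ξ′} .(p : constant ξ ∈ Constants) .(p′ : constant ξ′ ∈ Constants) →
                    ξ ≡ ξ′ → from ξ p ≡ from ξ′ p′
        from-cong _ _ refl = refl

        captured : ∀ {α} ξ → ξ < h α →
                   ∃[ x ] e.to x ≡ ξ × from (e.to x) (x , refl) < α → ξ ∈ φ α
        captured {α} ξ ξ<h (x , refl , β<α) =
          subst (_∈ φ α) (constant-≡ ξ α (<-≤-trans ξ<h (h≤b α)))
            (proj₂ (localise ξ (x , refl)) α β<α)

  -- The case of a value taken cofinally.

  constant-case :
    ∀ ν → Cofinal (D h ν) → IsAvoidanceCardinal b h ∣ ↓ ν ∣
  constant-case ν D-cofinal =
    (Constants ν≤κ , Constants-unlocalised ν≤κ diagonal , Constants-≈ᶜ ν≤κ bounded) , minimal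
    where
    ν≤κ : ∣ ↓ ν ∣ ≤ᶜ ∣κ∣
    ν≤κ = ∣∣≤κ (↓ ν)

    bounded : ∀ ((ξ , _) : ∃ (↓ ν)) → ∃[ α ] ξ < b α
    bounded (ξ , ξ<ν) with D-cofinal ξ
    ... | α , refl , _ = α , <-≤-trans ξ<ν (h≤b α)

    diagonal : (β : ∃ (↓ ν) → K) → (∀ {x y} → proj₁ x ≡ proj₁ y → β x ≡ β y) →
               ∃[ α ] ∀ ξ → ξ < h α → ∃[ x ] proj₁ x ≡ ξ × β x < α
    -- Regularity bounds the moments of capture by a single `δ`.
    diagonal β β-cong with bound ∣ ↓ ν ∣ (κ≰↓ ν) β (λ {x} {y} → β-cong {x} {y})
    ... | δ , β<δ with D-cofinal δ
    ...   | α , refl , δ≤α = α , λ ξ ξ<h → (ξ , ξ<h) , refl , <-≤-trans (β<δ (ξ , ξ<h)) δ≤α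

    -- Once `h` exceeds `ν` it stays above `ν`, which cofinality of `D h ν` excludes.
    eventually-ν : ∃[ β ] ∀ α → β < α → h α ≡ ν
    eventually-ν with D-cofinal ν
    ... | β , refl , _ = β , λ α β<α → case-≡ α (h↑ (inj₁ β<α)) (D-cofinal α)
      where
      case-≡ : ∀ α → h β ≤ h α → ∃[ γ ] h γ ≡ h β × α ≤ γ → h α ≡ h β
      case-≡ α (inj₂ eq) _ = sym eq
      case-≡ α (inj₁ hβ<hα) (γ , eq , α≤γ) =
        contradiction (subst (h α ≤_) eq (h↑ α≤γ)) (<⇒≱ hβ<hα)

    minimal : ∀ F → F ∈ Unlocalised b h → ∣ ↓ ν ∣ ≤ᶜ ∣ F ∣ᶠ
    minimal F F-unlocalised = by-contradiction λ ν≰F →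
      unlocalised-obstruction F-unlocalised (λ α f → f ∈ F × h α ≡ ν) (λ α → proj₁)
        -- The condition `h α ≡ ν` empties `E α` at early stages, where `h α` may be too small. As
        -- `h α` is nonzero, an injection into `E α` yields a member and with it this equation.
        (λ α h≤E → small ν≰F α h≤E (proj₂ (proj₂ (Injection.to h≤E (h-nonzero α)))))
        λ f f∈F → let β , h≡ν = eventually-ν in β , λ α β<α → f∈F , h≡ν α β<α
      where
      small : ¬ ∣ ↓ ν ∣ ≤ᶜ ∣ F ∣ᶠ → ∀ α →
              ∣ ↓ (h α) ∣ ≤ᶜ ∣ (λ f → f ∈ F × h α ≡ ν) ∣ᶠ → ¬ h α ≡ ν
      small ν≰F α h≤E refl = ν≰F (Comp.injection h≤E (⊆⇒≤ᶠ proj₁))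

  -- The cases in which every value is taken boundedly.

  module _ (D-bounded : ∀ ν → IsCardinal ν → Bounded (D h ν)) where

    -- If `h` stayed at or below `ξ`, regularity would give a `β` above the bounds of all the sets
    -- `D h ν` with `ν ≤ ξ`, and `h β` could have no value.
    h-unbounded : ∀ ξ → ∃[ α ] ξ < h α
    h-unbounded ξ = by-contradiction λ ¬above →
      let ξ⁺ , ξ<ξ⁺ = exceed ξ
          β , last<β = bound-↓ ξ⁺ last
          hβ≤ξ = ≮⇒≥ λ ξ<h → ¬above (β , ξ<h)
      in <⇒≱ (last<β (h β) (≤-<-trans hβ≤ξ ξ<ξ⁺)) (≤-last β)
      where
      last : K → K
      last ν with em {P = IsCardinal ν}
      ... | yes ν-cardinal = proj₁ (D-bounded ν ν-cardinal)
      -- A default never met at a value of `h`, since these are cardinals.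
      ... | no _ = ν

      ≤-last : ∀ β → β ≤ last (h β)
      ≤-last β with em {P = IsCardinal (h β)}
      ... | yes hβ-cardinal = proj₂ (D-bounded (h β) hβ-cardinal) β refl
      ... | no ¬card = contradiction (h-cardinal β) ¬card

    b-unbounded : ∀ ξ → ∃[ α ] ξ < b α
    b-unbounded ξ = let α , ξ<h = h-unbounded ξ in α , <-≤-trans ξ<h (h≤b α)

    -- By comparability `F` may be taken to inject into `κ`. If `κ` did not inject back, some `δ`
    -- would bound the indices, and `δ < h α` eventually.
    κ≤unlocalised : ∀ F → F ∈ Unlocalised b h → ∣κ∣ ≤ᶜ ∣ F ∣ᶠ
    κ≤unlocalised F F-unlocalised = fromInj₁ κ≤F (comparable ∣κ∣ ∣ F ∣ᶠ)
      where
      module _ (F≤κ : ∣ F ∣ᶠ ≤ᶜ ∣κ∣) where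
        module i = Injection F≤κ

        κ≤F : ∣κ∣ ≤ᶜ ∣ F ∣ᶠ
        κ≤F = by-contradiction λ κ≰F →
          let δ , i<δ = bound ∣ F ∣ᶠ κ≰F i.to i.cong
          in unlocalised-obstruction F-unlocalised (λ α f → f ∈ F × δ < h α) (λ α → proj₁)
            (λ α h≤E → cardinal-≰ (h-cardinal α)
              (proj₂ (proj₂ (Injection.to h≤E (h-nonzero α))))
              (Comp.injection h≤E record
                { to = λ (f , f∈F , _) → i.to (f , f∈F) , i<δ (f , f∈F)
                ; cong = i.cong
                ; injective = i.injective }))
            λ f f∈F → let β , δ<h = h-unbounded δ in
              β , λ α β<α → f∈F , <-≤-trans δ<h (h↑ (inj₁ β<α))

    continuous-case : ∃[ S ] Stationary S × ContinuousOn h S → IsAvoidanceCardinal b h ∣κ∣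
    continuous-case (S , S-stationary , h-continuous) =
      (Constants κ≤κ , Constants-unlocalised κ≤κ (λ β _ → diagonal β) ,
        Constants-≈ᶜ κ≤κ b-unbounded) , κ≤unlocalised
      where
      κ≤κ : ∣κ∣ ≤ᶜ ∣κ∣
      κ≤κ = Id.injection ∣κ∣

      -- Limits closed under both `β` and `h` form a club, which meets `S` in some `γ`. By
      -- continuity each `ξ < h γ` is below some `h α` with `α < γ`, hence below `γ`, and then
      -- `β ξ < γ`.
      diagonal : (β : K → K) → ∃[ α ] ∀ ξ → ξ < h α → ∃[ x ] x ≡ ξ × β x < α
      diagonal β = γ , λ ξ ξ<hγ → covered ξ (proj₁ (h-continuous γ γ∈S γ-limit) ξ<hγ)
        where
        g : K → K
        g ξ = proj₁ (upper-bound (β ξ) (h ξ))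

        C : Pred K ℓ
        C γ = IsLimit γ × γ ∈ ClosedUnder g

        C-closed : Closed C
        C-closed γ γ-limit C-unbounded = γ-limit , λ ξ ξ<γ →
          let η , (_ , η-closed) , ξ<η , η<γ = C-unbounded ξ ξ<γ
          in <-trans (η-closed ξ ξ<η) η<γ

        C-cofinal : Cofinal C
        C-cofinal β = let γ , β<γ , γ∈C = closure-point g β in γ , γ∈C , inj₁ β<γ

        meet = S-stationary C (C-closed , C-cofinal)
        γ = proj₁ meet
        γ∈S = proj₁ (proj₂ meet)
        γ-limit = proj₁ (proj₂ (proj₂ meet))
        γ-closed = proj₂ (proj₂ (proj₂ meet))

        covered : ∀ ξ → ξ ∈ ⋃< h γ → ∃[ x ] x ≡ ξ × β x < γ
        covered ξ (α , α<γ , ξ<hα) =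
          let _ , _ , hα≤g = upper-bound (β α) (h α)
              _ , βξ≤g , _ = upper-bound (β ξ) (h ξ)
              ξ<γ = <-trans (<-≤-trans ξ<hα hα≤g) (γ-closed α α<γ)
          in ξ , refl , ≤-<-trans βξ≤g (γ-closed ξ ξ<γ)

    -- Discontinuity on a club.

    module _ {C : Pred K ℓ} (C-club : Club C) (h-discontinuous : DiscontinuousOn h C) where

      -- A limit closed under passing to a larger point of `C` is a limit of points of `C`.
      limit-in-C : ∀ β → ∃[ γ ] β < γ × IsLimit γ × γ ∈ C
      limit-in-C β =
        let γ , β<γ , γ-limit , γ-closed = closure-point (proj₁ ∘ above) β
        in γ , β<γ , γ-limit , proj₁ C-club γ γ-limit λ α α<γ →
          let η , η∈C , α<η = above α in η , η∈C , α<η , γ-closed α α<γ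
        where
        above : ∀ α → ∃[ η ] η ∈ C × α < η
        above α =
          let β , α<β = exceed α
              η , η∈C , β≤η = proj₂ C-club β
          in η , η∈C , <-≤-trans α<β β≤η

      -- The union of sup h[γ] over the limits γ ≤ α in C. As it is attained
      -- at the largest such γ, discontinuity keeps it strictly below h α.
      Earlier : K → Pred K ℓ
      Earlier α ξ = ∃[ γ ] γ ≤ α × IsLimit γ × γ ∈ C × ξ ∈ ⋃< h γ

      Earlier-bounded : ∀ α → ∃[ δ ] δ < h α × Earlier α ⊆ ↓ δ
      Earlier-bounded α with em {P = ∃[ γ ] γ ≤ α × IsLimit γ × γ ∈ C}
      -- Here `Earlier α` is empty, so any point of the nonempty `h α` bounds it.
      ... | no none = let δ , δ<h = h-nonzero α in
        δ , δ<h , λ (γ , γ≤α , γ-limit , γ∈C , _) →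
          contradiction (γ , γ≤α , γ-limit , γ∈C) none
      ... | yes (γ₀ , γ₀≤α , γ₀-limit , γ₀∈C) =
        let δ , δ≐⋃ , δ<h = h-discontinuous σ σ∈C σ-limit
        in δ , <-≤-trans δ<h (h↑ σ≤α) ,
           λ (γ , γ≤α , γ-limit , γ∈C , η , η<γ , ξ<h) →
             proj₂ δ≐⋃ (η , <-≤-trans η<γ (≤σ γ (γ≤α , γ-limit , γ∈C)) , ξ<h)
        where
        Q : Pred K ℓ
        Q γ = γ ≤ α × IsLimit γ × γ ∈ C

        supremum = least (λ σ → ∀ γ → γ ∈ Q → γ ≤ σ) (α , λ γ → proj₁)
        σ = proj₁ supremum
        ≤σ = proj₁ (proj₂ supremum)
        σ≤α = proj₂ (proj₂ supremum) α λ γ → proj₁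

        -- If the supremum were not attained, points of `Q` would approach it from below, making it
        -- a limit of `C` and so a member of `Q` after all.
        σ∈Q : σ ∈ Q
        σ∈Q with em {P = σ ∈ Q}
        ... | yes σ∈Q = σ∈Q
        ... | no σ∉Q = σ≤α , σ-limit , proj₁ C-club σ σ-limit λ η η<σ →
            let γ , (γ≤α , γ-limit , γ∈C) , η<γ , γ<σ = approach η η<σ
            in γ , γ∈C , η<γ , γ<σ
          where
          Q<σ : ∀ γ → γ ∈ Q → γ < σ
          Q<σ γ γ∈Q = fromInj₁ (λ { refl → contradiction γ∈Q σ∉Q }) (≤σ γ γ∈Q)

          approach : ∀ η → η < σ → ∃[ γ ] γ ∈ Q × η < γ × γ < σ
          approach η η<σ = by-contradiction λ none →
            <⇒≱ η<σ (proj₂ (proj₂ supremum) η λ γ γ∈Q → ≮⇒≥ λ η<γ →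
              none (γ , γ∈Q , η<γ , Q<σ γ γ∈Q))

          σ-limit : IsLimit σ
          σ-limit = (γ₀ , Q<σ γ₀ (γ₀≤α , γ₀-limit , γ₀∈C)) , λ η η<σ →
            let γ , _ , η<γ , γ<σ = approach η η<σ in γ , η<γ , γ<σ

        σ-limit = proj₁ (proj₂ σ∈Q)
        σ∈C = proj₂ (proj₂ σ∈Q)

      unlocalised≰κ : ∀ F → F ∈ Unlocalised b h → ¬ ∣ F ∣ᶠ ≤ᶜ ∣κ∣
      unlocalised≰κ F F-unlocalised F≤κ =
        unlocalised-obstruction F-unlocalised E (λ α → proj₁)
          (λ α h≤E → let δ , δ<h , earlier<δ = Earlier-bounded α in
            cardinal-≰ (h-cardinal α) δ<h (Comp.injection h≤E record
              { to = λ (f , f∈F , earlier) → i.to (f , f∈F) , earlier<δ earlier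
              ; cong = i.cong
              ; injective = i.injective }))
          λ f f∈F →
            -- An index below `h η` belongs to `⋃< h γ` for any limit `γ` of `C` above `η`, so `f`
            -- lies in `E α` from there on.
            let η , i<h = h-unbounded (i.to (f , f∈F))
                γ , η<γ , γ-limit , γ∈C = limit-in-C η
            in γ , λ α γ<α → f∈F , γ , inj₁ γ<α , γ-limit , γ∈C , η , η<γ , i<h
        where
        module i = Injection F≤κ

        E : K → Pred (K → K) ℓ
        E α f = ∃[ f∈F ] i.to (f , f∈F) ∈ Earlier α

      -- The least size of an unlocalised family exists because `∏ b` is one. Being larger than `κ`,
      -- it also witnesses that `κ` has a successor cardinal.
      discontinuous-case :
        ∃[ κ⁺ ] IsSuccessorCardinal ∣κ∣ κ⁺ ×
          (∃[ 𝔟 ] IsAvoidanceCardinal b h 𝔟 × κ⁺ ≤ᶜ 𝔟)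
      discontinuous-case = conclude (least-cardinal-in ∣_∣ᶠ (Unlocalised b h) (∏ b , ∏b-unlocalised))
        where
        conclude : ∃[ F ] F ∈ Unlocalised b h × (∀ G → G ∈ Unlocalised b h → ∣ F ∣ᶠ ≤ᶜ ∣ G ∣ᶠ) →
                   ∃[ κ⁺ ] IsSuccessorCardinal ∣κ∣ κ⁺ ×
                     (∃[ 𝔟 ] IsAvoidanceCardinal b h 𝔟 × κ⁺ ≤ᶜ 𝔟)
        conclude (F , F-unlocalised , F≤) =
          let κ<F = κ≤unlocalised F F-unlocalised , unlocalised≰κ F F-unlocalised
              κ⁺ , κ⁺-successor = successor-cardinal κ<F
          in κ⁺ , κ⁺-successor , ∣ F ∣ᶠ ,
             ((F , F-unlocalised , Id.bijection ∣ F ∣ᶠ) , F≤) , proj₂ κ⁺-successor ∣ F ∣ᶠ κ<F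

lemma3p17 : (∀ {a} → ExcludedMiddle a) →
    (∀ {a b} → Extensionality a b) →
    ∀ {ℓ} (κ : Ordinal ℓ) → let open Below κ in
    Inaccessible →
    (b h : K → K) →
    Increasing b →
    Increasing h →
    (∀ α → h α ≤ b α) →
    (∀ α → IsCardinal (b α) × IsInfinite (b α)) →
    (∀ α → IsCardinal (h α) × Satisfiable (↓ (h α))) →
    (∀ ν → IsCardinal ν → Cofinal (D h ν) →
    (∀ μ → IsCardinal μ → Cofinal (D h μ) → ν ≤ μ) →
    IsAvoidanceCardinal b h ∣ ↓ ν ∣)
    ×
    ((∀ ν → IsCardinal ν → Bounded (D h ν)) →
    (∃[ S ] Stationary S × ContinuousOn h S) →
    IsAvoidanceCardinal b h ∣κ∣)
    ×
    ((∀ ν → IsCardinal ν → Bounded (D h ν)) →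
    (∃[ C ] Club C × DiscontinuousOn h C) →
    ∃[ κ⁺ ] IsSuccessorCardinal ∣κ∣ κ⁺ ×
    (∃[ 𝔟 ] IsAvoidanceCardinal b h 𝔟 × κ⁺ ≤ᶜ 𝔟))
lemma3p17 em ext κ inaccessible b h b↑ h↑ h≤b b-card h-card =
  (λ ν _ D-cofinal _ → L.constant-case ν D-cofinal) ,
  L.continuous-case ,
  λ D-bounded (C , C-club , h-discontinuous) →
    L.discontinuous-case D-bounded C-club h-discontinuous
  where
  module L = Localisation em ext κ inaccessible b h b↑ h↑ h≤b
    (proj₂ ∘ b-card) (proj₁ ∘ h-card) (proj₂ ∘ h-card)
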